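{- Let $n \geq 2$ be a fixed integer, and for each integer $k \geq 0$ let $G_k := KG(2n+k,n)$ be the Kneser graph. Then $$\varphi(G_k) \leq (1+o(1))\,\frac{|V(G_k)|}{3},$$ where the $o(1)$ term tends to zero as $k \to \infty$ (with $n$ fixed). That is, for every fixed integer $n \geq 2$ there exists a function $\varepsilon_n : \mathbb{Z}_{\geq 0} \to \mathbb{R}$ with $\lim_{k\to\infty} \varepsilon_n(k) = 0$ such that $\varphi(G_k) \leq (1+\varepsilon_n(k))\,\frac{|V(G_k)|}{3}$ for all integers $k \geq 0$.
   Context: All graphs are simple, with nonempty finite vertex sets. Coloring: a coloring of a graph $G$ is a function $f : V(G) \to C$ such that for each $c \in C$ the set $f^{ -1}(c)$ is independent; the elements of $C$ are called colors, and $f^{ -1}(c)$ is called a color class of $f$. Color-dominating vertex: given a coloring $f : V(G) \to C$, a vertex $v$ is color-dominating with respect to $f$ if $f(N[v]) = C$, where $N[v]$ is the closed neighborhood of $v$ (that is, $v$ together with all its neighbors). b-coloring: a coloring $f : V(G) \to C$ is a b-coloring if each of its color classes $f^{ -1}(c)$, $c \in C$, contains at least one color-dominating vertex. b-chromatic number: $\varphi(G)$ is the maximum positive integer $k$ for which $G$ admits a b-coloring $f : V(G) \to C$ with $|C| = k$. Kneser graph: for positive integers $N \geq m$, $KG(N,m)$ is the graph whose vertices are all $m$-element subsets of $\{1,2,\ldots,N\}$, two vertices $A$ and $B$ being adjacent if and only if $A \cap B = \varnothing$. In particular $|V(KG(2n+k,n))| = \binom{2n+k}{n}$. -}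

module Defs where

open import Data.Bool.Base using (true; false)
open import Data.Fin.Base using (Fin; zero; suc; finToFun; funToFin; punchOut)
open import Data.Fin.Properties as Fin
  using (any?; +↔⊎; finToFun-funToFin; injective⇒≤; punchOut-injective; ¬∀⟶∃¬)
open import Data.Fin.Subset using (Subset; ∣_∣; _∩_; ⊥)
open import Data.Fin.Subset.Properties using (∣⊥∣≡0; ∩-idem; ∩-comm)
import Data.Bool.Properties as Bool
open import Data.Nat.Base using (ℕ; zero; suc; _^_; _≤_; z≤n; s≤s; s≤s⁻¹; NonZero)
open import Data.Nat.Combinatorics using (_C_; nCk+nC[k+1]≡[n+1]C[k+1])
open import Data.Nat.Properties as ℕₚ using (m≤n⇒m<n∨m≡n)
open import Data.Product.Base using (Σ; ∃; _×_; _,_; proj₁; proj₂)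
open import Data.Rational.Base as ℚ using (ℚ; 0ℚ)
open import Data.Sum.Base using (_⊎_; inj₁; inj₂)
open import Data.Sum.Function.Propositional using (_⊎-↔_)
open import Data.Vec.Base using ([]; _∷_)
open import Data.Vec.Properties using (≡-dec)
open import Function.Base using (_∘_)
open import Function.Bundles using (_↔_; mk↔ₛ′; Inverse)
open import Function.Construct.Composition using (_↔-∘_)
open import Function.Construct.Symmetry using (↔-sym)
open import Level using (0ℓ)
open import Relation.Binary.Core using (Rel)
import Relation.Binary.Definitions as B
open import Relation.Binary.PropositionalEquality
open import Relation.Nullary
open import Relation.Nullary.Decidable using (map′; _×-dec_; _⊎-dec_; _→-dec_; ¬?)
open import Relation.Unary using (Pred; Decidable)

record Graph : Set₁ where
  infix 4 _~_ _~?_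
  field
    Vertex   : Set
    _~_      : Rel Vertex 0ℓ
    ~-irrefl : ∀ {v} → ¬ (v ~ v)
    ~-sym    : B.Symmetric _~_
    _~?_     : B.Decidable _~_
    order    : ℕ
    enum     : Vertex ↔ Fin order
    nonEmpty : NonZero order

∣V_∣ : Graph → ℕ
∣V G ∣ = Graph.order G

module Coloring (G : Graph) where
  open Graph G

  Independent : Pred Vertex 0ℓ → Set
  Independent S = ∀ {u v} → S u → S v → ¬ (u ~ v)

  N[_] : Vertex → Pred Vertex 0ℓ
  N[ v ] u = u ≡ v ⊎ v ~ u

  Class : {C : Set} → (Vertex → C) → C → Pred Vertex 0ℓ
  Class f c v = f v ≡ c

  IsColoring : {C : Set} → (Vertex → C) → Set
  IsColoring f = ∀ c → Independent (Class f c)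

  -- f(N[v]) = C; only the inclusion of C in f(N[v]) has content.
  ColorDominating : {C : Set} → (Vertex → C) → Vertex → Set
  ColorDominating f v = ∀ c → ∃ λ u → N[ v ] u × f u ≡ c

  IsBColoring : {C : Set} → (Vertex → C) → Set
  IsBColoring f = IsColoring f × (∀ c → ∃ λ v → Class f c v × ColorDominating f v)

  -- Up to renaming colors, Fin k is the only color set with k elements.
  HasBColoring : ℕ → Set
  HasBColoring k = ∃ λ (f : Vertex → Fin k) → IsBColoring f

  IsBChromaticNumber : ℕ → Set
  IsBChromaticNumber k =
    1 ≤ k × HasBColoring k × (∀ j → 1 ≤ j → HasBColoring j → j ≤ k)

greatest : {P : Pred ℕ 0ℓ} → Decidable P → ∀ b → (∀ j → P j → j ≤ b) → ∃ P →
           ∃ λ k → P k × (∀ j → P j → j ≤ k)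
greatest P? b bnd w with P? b
... | yes p = b , p , bnd
greatest P? zero bnd (k , p) | no ¬p with z≤n ← bnd k p = contradiction p ¬p
greatest {P} P? (suc b) bnd w | no ¬p = greatest P? b bnd′ w
  where
  bnd′ : ∀ j → P j → j ≤ b
  bnd′ j pj with m≤n⇒m<n∨m≡n (bnd j pj)
  ... | inj₁ j<  = s≤s⁻¹ j<
  ... | inj₂ refl = contradiction pj ¬p

module Existence (G : Graph) where
  open Graph G
  open Coloring G
  open Inverse enum using (to; from; strictlyInverseˡ; strictlyInverseʳ)

  to-injective : ∀ {u v} → to u ≡ to v → u ≡ v
  to-injective {u} {v} eq =
    trans (sym (strictlyInverseʳ u)) (trans (cong from eq) (strictlyInverseʳ v))

  _≟V_ : B.DecidableEquality Vertex
  u ≟V v = map′ to-injective (cong to) (to u Fin.≟ to v)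

  someV : {P : Pred Vertex 0ℓ} → Decidable P → Dec (∃ P)
  someV {P} P? = map′ (λ (i , p) → from i , p)
                      (λ (v , p) → to v , subst P (sym (strictlyInverseʳ v)) p)
                      (any? (P? ∘ from))

  everyV : {P : Pred Vertex 0ℓ} → Decidable P → Dec (∀ v → P v)
  everyV {P} P? = map′ (λ h v → subst P (strictlyInverseʳ v) (h (to v)))
                       (λ h i → h (from i))
                       (Fin.all? (P? ∘ from))

  dominating? : ∀ {k} (f : Vertex → Fin k) → Decidable (ColorDominating f)
  dominating? f v = Fin.all? λ c → someV λ u → ((u ≟V v) ⊎-dec (v ~? u)) ×-dec (f u Fin.≟ c)

  HasDominating : ∀ {k} → (Vertex → Fin k) → Fin k → Set
  HasDominating f c = ∃ λ v → Class f c v × ColorDominating f v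

  hasDominating? : ∀ {k} (f : Vertex → Fin k) → Decidable (HasDominating f)
  hasDominating? f c = someV λ v → (f v Fin.≟ c) ×-dec dominating? f v

  isColoring? : ∀ {k} (f : Vertex → Fin k) → Dec (IsColoring f)
  isColoring? f = map′ (λ h c {u} {v} → h c u v) (λ h c u v → h c {u} {v})
    (Fin.all? λ c → everyV λ u → everyV λ v →
      (f u Fin.≟ c) →-dec ((f v Fin.≟ c) →-dec ¬? (u ~? v)))

  isBColoring? : ∀ {k} (f : Vertex → Fin k) → Dec (IsBColoring f)
  isBColoring? f = isColoring? f ×-dec Fin.all? (hasDominating? f)

  isBColoring-resp : {C : Set} {f g : Vertex → C} → f ≗ g → IsBColoring f → IsBColoring g
  isBColoring-resp f≗g (col , dom) =
    (λ c gu gv → col c (trans (f≗g _) gu) (trans (f≗g _) gv)) ,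
    (λ c → let (v , fv , d) = dom c in
      v , trans (sym (f≗g v)) fv ,
      λ c′ → let (u , n , fu) = d c′ in u , n , trans (sym (f≗g u)) fu)

  hasBColoring? : Decidable HasBColoring
  hasBColoring? k = map′ (λ (i , b) → finToFun i ∘ to , b) bwd
                         (any? λ (i : Fin (k ^ order)) → isBColoring? (finToFun i ∘ to))
    where
    bwd : HasBColoring k → ∃ λ (i : Fin (k ^ order)) → IsBColoring (finToFun i ∘ to)
    bwd (f , b) = funToFin (f ∘ from) , isBColoring-resp
      (λ v → sym (trans (finToFun-funToFin (f ∘ from) (to v))
                        (cong f (strictlyInverseʳ v)))) b

  -- If class c has no color-dominating vertex, each of its vertices can be
  -- recolored with a color missing from its closed neighborhood.
  module Recolor {k} (f : Vertex → Fin (suc k)) (col : IsColoring f)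
                 (c : Fin (suc k)) (¬dom : ¬ HasDominating f c) where

    missing : ∀ v → f v ≡ c → ∃ λ d → ∀ u → N[ v ] u → f u ≢ d
    missing v fv≡c with ¬∀⟶∃¬ _ _ (λ d → someV λ u → ((u ≟V v) ⊎-dec (v ~? u)) ×-dec (f u Fin.≟ d))
                                (λ d → ¬dom (v , fv≡c , d))
    ... | d , ¬p = d , λ u n eq → ¬p (u , n , eq)

    recolor : ∀ v → Dec (f v ≡ c) → Fin (suc k)
    recolor v (yes e) = proj₁ (missing v e)
    recolor v (no _)  = f v

    recolor-≢ : ∀ v d → c ≢ recolor v d
    recolor-≢ v (yes e) c≡d = proj₂ (missing v e) v (inj₁ refl) (trans e c≡d)
    recolor-≢ v (no ¬e) c≡d = ¬e (sym c≡d)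

    recolor-proper : ∀ u v du dv → recolor u du ≡ recolor v dv → ¬ (u ~ v)
    recolor-proper u v (yes e) (yes e′) _  a = col c e e′ a
    recolor-proper u v (yes e) (no _)   eq a = proj₂ (missing u e) v (inj₂ a) (sym eq)
    recolor-proper u v (no _)  (yes e)  eq a = proj₂ (missing v e) u (inj₂ (~-sym a)) eq
    recolor-proper u v (no _)  (no _)   eq a = col (f v) eq refl a

    g : Vertex → Fin k
    g v = punchOut (recolor-≢ v (f v Fin.≟ c))

    g-coloring : IsColoring g
    g-coloring d {u} {v} gu gv = recolor-proper u v (f u Fin.≟ c) (f v Fin.≟ c)
      (punchOut-injective (recolor-≢ u (f u Fin.≟ c)) (recolor-≢ v (f v Fin.≟ c)) (trans gu (sym gv)))

  coloring⇒bColoring : ∀ {k} (f : Vertex → Fin k) → IsColoring f → ∃ HasBColoring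
  coloring⇒bColoring {zero}  f col = zero , f , col , λ ()
  coloring⇒bColoring {suc k} f col with Fin.all? (hasDominating? f)
  ... | yes dom = suc k , f , col , dom
  ... | no ¬dom with c , ¬d ← ¬∀⟶∃¬ _ _ (hasDominating? f) ¬dom =
    let open Recolor f col c ¬d in coloring⇒bColoring g g-coloring

  bound : ∀ j → HasBColoring j → j ≤ order
  bound j (f , _ , dom) = injective⇒≤ {f = λ c → to (proj₁ (dom c))} λ {c} {d} eq →
    trans (sym (proj₁ (proj₂ (dom c))))
          (trans (cong f (to-injective eq)) (proj₁ (proj₂ (dom d))))

  someVertex : Vertex
  someVertex = from (first nonEmpty)
    where
    first : ∀ {n} → NonZero n → Fin n
    first {suc n} _ = zero

  positive : ∀ k → HasBColoring k → 1 ≤ k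
  positive zero    (f , _) with () ← f someVertex
  positive (suc k) _       = s≤s z≤n

  bChromatic : ∃ IsBChromaticNumber
  bChromatic with greatest hasBColoring? order bound
                    (coloring⇒bColoring to λ c eu ev a →
                      ~-irrefl (subst (_~ _) (to-injective (trans eu (sym ev))) a))
  ... | k , p , max = k , positive k p , p , λ j _ → max j

abstract
  φ : Graph → ℕ
  φ G = proj₁ (Existence.bChromatic G)

  φ-isBChromaticNumber : ∀ G → Coloring.IsBChromaticNumber G (φ G)
  φ-isBChromaticNumber G = proj₂ (Existence.bChromatic G)

SubsetOfSize : ℕ → ℕ → Set
SubsetOfSize N m = Σ (Subset N) λ A → ∣ A ∣ ≡ m

subset-≡ : ∀ {N m} {A B : SubsetOfSize N m} → proj₁ A ≡ proj₁ B → A ≡ B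
subset-≡ {A = _ , p} {B = _ , q} refl = cong (_ ,_) (ℕₚ.≡-irrelevant p q)

subset-zero : ∀ N → SubsetOfSize N 0 ↔ Fin 1
subset-zero N = mk↔ₛ′ (λ _ → zero) (λ _ → ⊥ , ∣⊥∣≡0 N) (λ { zero → refl })
                      (λ (A , p) → subset-≡ (sym (empty A p)))
  where
  empty : ∀ {N} (A : Subset N) → ∣ A ∣ ≡ 0 → A ≡ ⊥
  empty []          p = refl
  empty (false ∷ A) p = cong (false ∷_) (empty A p)

subset-suc : ∀ N m → SubsetOfSize (suc N) (suc m) ↔ (SubsetOfSize N m ⊎ SubsetOfSize N (suc m))
subset-suc N m = mk↔ₛ′ split glue split-glue glue-split
  where
  split : SubsetOfSize (suc N) (suc m) → SubsetOfSize N m ⊎ SubsetOfSize N (suc m)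
  split (true  ∷ A , p) = inj₁ (A , ℕₚ.suc-injective p)
  split (false ∷ A , p) = inj₂ (A , p)
  glue : SubsetOfSize N m ⊎ SubsetOfSize N (suc m) → SubsetOfSize (suc N) (suc m)
  glue (inj₁ (A , p)) = true  ∷ A , cong suc p
  glue (inj₂ (A , p)) = false ∷ A , p
  split-glue : ∀ x → split (glue x) ≡ x
  split-glue (inj₁ _) = cong inj₁ (subset-≡ refl)
  split-glue (inj₂ _) = refl
  glue-split : ∀ x → glue (split x) ≡ x
  glue-split (true  ∷ A , p) = subset-≡ refl
  glue-split (false ∷ A , p) = refl

subset↔Fin : ∀ N m → SubsetOfSize N m ↔ Fin (N C m)
subset↔Fin N       zero    = subset-zero N
subset↔Fin zero    (suc m) = mk↔ₛ′ (λ { ([] , ()) }) (λ ()) (λ ()) (λ { ([] , ()) })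
subset↔Fin (suc N) (suc m) =
  subst (λ b → SubsetOfSize (suc N) (suc m) ↔ Fin b) (nCk+nC[k+1]≡[n+1]C[k+1] N m)
    (↔-sym +↔⊎ ↔-∘ ((subset↔Fin N m ⊎-↔ subset↔Fin N (suc m)) ↔-∘ subset-suc N m))

someSubset : ∀ {N m} → m ≤ N → SubsetOfSize N m
someSubset {N} z≤n     = ⊥ , ∣⊥∣≡0 N
someSubset     (s≤s h) = let (A , p) = someSubset h in true ∷ A , cong suc p

KG : (N m : ℕ) → 1 ≤ m → m ≤ N → Graph
KG N m 1≤m m≤N = record
  { Vertex   = SubsetOfSize N m
  ; _~_      = λ (A , _) (B , _) → A ∩ B ≡ ⊥
  ; ~-irrefl = λ {(A , p)} A∩A≡⊥ → ℕₚ.<⇒≢ 1≤m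
      (trans (sym (∣⊥∣≡0 N)) (trans (cong ∣_∣ (trans (sym A∩A≡⊥) (∩-idem A))) p))
  ; ~-sym    = λ {(A , _)} {(B , _)} e → trans (∩-comm B A) e
  ; _~?_     = λ (A , _) (B , _) → ≡-dec Bool._≟_ (A ∩ B) ⊥
  ; order    = N C m
  ; enum     = subset↔Fin N m
  ; nonEmpty = Fin.nonZeroIndex (Inverse.to (subset↔Fin N m) (someSubset m≤N))
  }

-- A rational-valued error term loses nothing against a real-valued one: if
-- a ≤ (1 + ε) b with b > 0 and a, b rational, then ε may be replaced by
-- max(0, a/b − 1), which lies between 0 and ∣ε∣.
_⟶0 : (ℕ → ℚ) → Set
ε ⟶0 = ∀ (δ : ℚ) → 0ℚ ℚ.< δ → ∃ λ K → ∀ k → K ≤ k → ℚ.∣ ε k ∣ ℚ.< δ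

{-# OPTIONS --safe #-}

-- In a b-coloring of a Kneser graph, call a color class a star if some point
-- x lies in all of its members.  Two star classes never share a point x: the
-- dominating vertex of one contains x, while it must have a neighbor in, i.e.
-- be disjoint from some member of, the other.  A class with at most two
-- members is a star, because its members intersect pairwise.  So every class
-- that is not among the at most N stars has three members, and giving each
-- star class two extra tokens yields 3 φ ≤ |V| + 2N.  For n ≥ 2 the number
-- |V| of vertices is at least quadratic in N.

module Submission where

open import Defs
open import Data.Nat.Base using (ℕ; _≤_; _+_; _*_)
open import Data.Nat.Properties using (<⇒≤; ≤-trans; m≤m+n)
open import Data.Integer.Base using (+_)
open import Data.Rational.Base as ℚ using (ℚ; 1ℚ; _/_)
open import Data.Product.Base using (∃; _×_)

open import Data.Fin.Base using (Fin; zero; suc)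
open import Data.Fin.Properties as Fin using (+↔⊎; *↔×; injective⇒≤)
open import Data.Fin.Subset using (Subset; _∈_; ⊥; Nonempty)
open import Data.Fin.Subset.Properties
  using (nonempty?; Empty-unique; ∉⊥; x∈p∩q⁺; x∈p∩q⁻)
open import Data.Integer.Base as ℤ using (+<+; +≤+)
import Data.Integer.Properties as ℤₚ
open import Data.Nat.Base using (zero; suc; _<_; s≤s)
open import Data.Nat.Combinatorics using (_C_; nCk+nC[k+1]≡[n+1]C[k+1])
import Data.Nat.Properties as ℕₚ
open import Data.Nat.Solver using (module +-*-Solver)
open import Data.Product.Base using (_,_; proj₁; proj₂)
open import Data.Rational.Base using (mkℚ; *<*; toℚᵘ)
import Data.Rational.Properties as ℚₚ
open import Data.Rational.Unnormalised.Base as ℚᵘ using (mkℚᵘ; 1ℚᵘ)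
import Data.Rational.Unnormalised.Properties as ℚᵘₚ
open import Data.Sum.Base using (_⊎_; inj₁; inj₂)
import Data.Sum.Properties as ⊎
open import Data.Sum.Function.Propositional using (_⊎-↔_)
open import Function.Base using (_∘_)
open import Function.Bundles using (Injection; _↣_; mk↣)
open import Function.Construct.Composition using (_↔-∘_; _↣-∘_)
open import Function.Construct.Symmetry using (↔-sym)
open import Function.Properties.Inverse using (↔⇒↣)
open import Relation.Binary.PropositionalEquality
open import Relation.Nullary
open import Relation.Nullary.Decidable using (_×-dec_; ¬?; decidable-stable)

-- Nonempty subsets and injective triples

≢⊥⇒nonempty : ∀ {N} {A : Subset N} → A ≢ ⊥ → Nonempty A
≢⊥⇒nonempty {A = A} A≢⊥ =
  decidable-stable (nonempty? A) (A≢⊥ ∘ Empty-unique)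

triple : {A : Set} → A → A → A → Fin 3 → A
triple a b c zero             = a
triple a b c (suc zero)       = b
triple a b c (suc (suc zero)) = c

triple-injective : {A : Set} {a b c : A} → a ≢ b → a ≢ c → b ≢ c →
                   ∀ {s t} → triple a b c s ≡ triple a b c t → s ≡ t
triple-injective a≢b a≢c b≢c {zero}           {zero}           _  = refl
triple-injective a≢b a≢c b≢c {zero}           {suc zero}       eq = contradiction eq a≢b
triple-injective a≢b a≢c b≢c {zero}           {suc (suc zero)} eq = contradiction eq a≢c
triple-injective a≢b a≢c b≢c {suc zero}       {zero}           eq = contradiction (sym eq) a≢b
triple-injective a≢b a≢c b≢c {suc zero}       {suc zero}       _  = refl
triple-injective a≢b a≢c b≢c {suc zero}       {suc (suc zero)} eq = contradiction eq b≢c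
triple-injective a≢b a≢c b≢c {suc (suc zero)} {zero}           eq = contradiction (sym eq) a≢c
triple-injective a≢b a≢c b≢c {suc (suc zero)} {suc zero}       eq = contradiction (sym eq) b≢c
triple-injective a≢b a≢c b≢c {suc (suc zero)} {suc (suc zero)} _  = refl

triple-all : {A : Set} {a b c : A} (P : A → Set) → P a → P b → P c →
             ∀ t → P (triple a b c t)
triple-all P pa pb pc zero             = pa
triple-all P pa pb pc (suc zero)       = pb
triple-all P pa pb pc (suc (suc zero)) = pc

-- Counting tokens in a b-coloring of a Kneser graph

module KneserBColoring (N m : ℕ) (1≤m : 1 ≤ m) (m≤N : m ≤ N) where
  private G = KG N m 1≤m m≤N
  open Graph G
  open Coloring G
  open Existence G using (someV; _≟V_)

  -- Nonadjacency only denies that the intersection is `⊥`; decidability of nonemptiness turns this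
  -- into an actual point.
  nonadjacent⇒intersecting : ∀ {u v} → ¬ (u ~ v) → ∃ λ x → x ∈ proj₁ u × x ∈ proj₁ v
  nonadjacent⇒intersecting {u , _} {v , _} u≁v =
    let x , x∈u∩v = ≢⊥⇒nonempty u≁v in x , x∈p∩q⁻ u v x∈u∩v

  adjacent⇒disjoint : ∀ {u v x} → u ~ v → x ∈ proj₁ u → ¬ (x ∈ proj₁ v)
  adjacent⇒disjoint u~v x∈u x∈v = ∉⊥ (subst (_ ∈_) u~v (x∈p∩q⁺ (x∈u , x∈v)))

  module _ {c : ℕ} (f : Vertex → Fin c) (b : IsBColoring f) where
    Star : Fin c → Fin N → Set
    Star i x = ∀ v → Class f i v → x ∈ proj₁ v

    star-unique : ∀ {i j x} → Star i x → Star j x → i ≡ j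
    star-unique {i} {j} si sj with proj₂ b i
    ... | v , fv , dom with dom j
    -- Domination refers to closed neighborhoods, so the vertex of color `j` may be `v` itself.
    ...   | u , inj₁ refl , fu = trans (sym fv) fu
    ...   | u , inj₂ v~u  , fu = contradiction (sj u fu) (adjacent⇒disjoint {v} {u} v~u (si v fv))

    -- One token per vertex and two per point. Indexing the extra tokens by points rather than by
    -- star classes fixes their number at 2N; `star-unique` ensures that no two colors claim the
    -- same one.
    Token : Set
    Token = Vertex ⊎ (Fin N × Fin 2)

    Owns : Fin c → Token → Set
    Owns i (inj₁ v)       = Class f i v
    Owns i (inj₂ (x , _)) = Star i x

    owner-unique : ∀ {i j} t → Owns i t → Owns j t → i ≡ j
    owner-unique (inj₁ v)       fv fv′ = trans (sym fv) fv′
    owner-unique (inj₂ (x , _)) si sj  = star-unique si sj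

    OwnsThree : Fin c → Set
    OwnsThree i = ∃ λ (g : Fin 3 → Token) →
      (∀ {s t} → g s ≡ g t → s ≡ t) × (∀ t → Owns i (g t))

    star⇒ownsThree : ∀ i {x} → Star i x → OwnsThree i
    star⇒ownsThree i {x} s =
      let v , fv , _ = proj₂ b i in
      triple (inj₁ v) (inj₂ (x , zero)) (inj₂ (x , suc zero)) ,
      triple-injective (λ ()) (λ ()) (λ ()) ,
      triple-all (Owns i) fv s s

    ownsThree : ∀ i → OwnsThree i
    ownsThree i with proj₂ b i
    ... | d , fd , _ with someV (λ e → ¬? (d ≟V e) ×-dec (f e Fin.≟ i))
    -- The class is `d` alone. Irreflexivity of `~` makes `d` meet itself, which yields a point of
    -- `d` to serve as the center of the star.
    ...   | no ∄e = star⇒ownsThree i λ v fv →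
              subst (λ w → proj₁ x∈d ∈ proj₁ w)
                    (decidable-stable (d ≟V v) λ d≢v → ∄e (v , d≢v , fv))
                    (proj₁ (proj₂ x∈d))
      where x∈d = nonadjacent⇒intersecting {d} {d} (~-irrefl {d})
    ...   | yes (e , d≢e , fe)
            with someV (λ w → ¬? (d ≟V w) ×-dec (¬? (e ≟V w) ×-dec (f w Fin.≟ i)))
    ...     | yes (w , d≢w , e≢w , fw) =
              triple (inj₁ d) (inj₁ e) (inj₁ w) ,
              triple-injective (d≢e ∘ ⊎.inj₁-injective) (d≢w ∘ ⊎.inj₁-injective)
                               (e≢w ∘ ⊎.inj₁-injective) ,
              triple-all (Owns i) fd fe fw
    ...     | no ∄w
              with x , x∈d , x∈e ← nonadjacent⇒intersecting {d} {e} (proj₁ b i {d} {e} fd fe) =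
              star⇒ownsThree i star
      where
      star : Star i x
      star v fv with d ≟V v | e ≟V v
      ... | yes refl | _        = x∈d
      ... | no _     | yes refl = x∈e
      ... | no d≢v   | no e≢v   = contradiction (v , d≢v , e≢v , fv) ∄w

    -- A token determines its owner by `owner-unique`; once the colors agree, injectivity of that
    -- color's own triple finishes.
    deal : (Fin c × Fin 3) ↣ Token
    deal = mk↣ {to = to} injective
      where
      to : Fin c × Fin 3 → Token
      to (i , t) = proj₁ (ownsThree i) t
      owned : ∀ i t → Owns i (to (i , t))
      owned i = proj₂ (proj₂ (ownsThree i))
      injective : ∀ {p q} → to p ≡ to q → p ≡ q
      injective {i , s} {j , t} eq
        with refl ← owner-unique (to (i , s)) (owned i s) (subst (Owns j) (sym eq) (owned j t))
        = cong (i ,_) (proj₁ (proj₂ (ownsThree i)) eq)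

    3colors≤order+2N : c * 3 ≤ order + N * 2
    3colors≤order+2N = injective⇒≤ (Injection.injective
      (↔⇒↣ (↔-sym +↔⊎ ↔-∘ (enum ⊎-↔ ↔-sym *↔×)) ↣-∘ (deal ↣-∘ ↔⇒↣ *↔×)))

3φ≤order+2N : ∀ N m 1≤m m≤N → let G = KG N m 1≤m m≤N in φ G * 3 ≤ ∣V G ∣ + N * 2
3φ≤order+2N N m 1≤m m≤N with φ-isBChromaticNumber (KG N m 1≤m m≤N)
... | _ , (f , b) , _ = KneserBColoring.3colors≤order+2N N m 1≤m m≤N f b

-- Quadratic growth of binomial coefficients

C-positive : ∀ j r → 1 ≤ (j + r) C j
C-positive zero    r = ℕₚ.≤-refl
C-positive (suc j) r = begin
  1                                  ≤⟨ C-positive j r ⟩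
  (j + r) C j                        ≤⟨ m≤m+n _ _ ⟩
  (j + r) C j + (j + r) C (suc j)    ≡⟨ nCk+nC[k+1]≡[n+1]C[k+1] (j + r) j ⟩
  (suc j + r) C (suc j)              ∎
  where open ℕₚ.≤-Reasoning

C-lower-linear : ∀ j r → 1 + r ≤ (1 + j + r) C (1 + j)
C-lower-linear j zero    = C-positive (suc j) 0
C-lower-linear j (suc r) = begin
  1 + (1 + r)
    ≤⟨ ℕₚ.+-mono-≤ (C-positive j (suc r)) (C-lower-linear j r) ⟩
  (j + suc r) C j + (1 + j + r) C (1 + j)
    ≡⟨ cong (λ m → (j + suc r) C j + m C (1 + j)) (ℕₚ.+-suc j r) ⟨
  (j + suc r) C j + (j + suc r) C (1 + j)
    ≡⟨ nCk+nC[k+1]≡[n+1]C[k+1] (j + suc r) j ⟩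
  (1 + j + suc r) C (1 + j) ∎
  where open ℕₚ.≤-Reasoning

-- The left side is twice `(2 + r) C 2`, so `j = 0` gives equality. From `r` to `suc r` it grows by
-- 2(2 + r), while Pascal's rule adds to the right side a term that `C-lower-linear` shows to be at
-- least as large.
C-lower-quadratic : ∀ j r → (1 + r) * (2 + r) ≤ 2 * ((2 + j + r) C (2 + j))
C-lower-quadratic j zero    = ℕₚ.*-monoʳ-≤ 2 (C-positive (2 + j) 0)
C-lower-quadratic j (suc r) = begin
  (2 + r) * (3 + r)
    ≡⟨ solve 1 (λ r → (con 2 :+ r) :* (con 3 :+ r) :=
         con 2 :* (con 2 :+ r) :+ (con 1 :+ r) :* (con 2 :+ r)) refl r ⟩
  2 * (2 + r) + (1 + r) * (2 + r)
    ≤⟨ ℕₚ.+-mono-≤ (ℕₚ.*-monoʳ-≤ 2 (C-lower-linear j (suc r))) (C-lower-quadratic j r) ⟩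
  2 * ((1 + j + suc r) C (1 + j)) + 2 * ((2 + j + r) C (2 + j))
    ≡⟨ ℕₚ.*-distribˡ-+ 2 ((1 + j + suc r) C (1 + j)) ((2 + j + r) C (2 + j)) ⟨
  2 * ((1 + j + suc r) C (1 + j) + (2 + j + r) C (2 + j))
    ≡⟨ cong (λ m → 2 * ((1 + j + suc r) C (1 + j) + (1 + m) C (2 + j))) (ℕₚ.+-suc j r) ⟨
  2 * ((1 + j + suc r) C (1 + j) + (1 + j + suc r) C (2 + j))
    ≡⟨ cong (2 *_) (nCk+nC[k+1]≡[n+1]C[k+1] (1 + j + suc r) (1 + j)) ⟩
  2 * ((2 + j + suc r) C (2 + j)) ∎
  where
  open ℕₚ.≤-Reasoning
  open +-*-Solver

-- This is c ≤ (1 + 8/(1 + r)) V/3 with denominators cleared. The 8 arises from 2N ≤ 4r ≤ 4(2 + r):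
-- multiplied by 1 + r, the last bound is four times the product that `2 * V` dominates.
quadratic-absorbs-linear : ∀ c N V r → N ≤ r + r → c * 3 ≤ V + N * 2 →
                           (1 + r) * (2 + r) ≤ 2 * V → c * 3 * suc r ≤ (suc r + 8) * V
quadratic-absorbs-linear c N V r N≤2r 3c≤ quad = begin
  c * 3 * suc r
    ≤⟨ ℕₚ.*-monoˡ-≤ (suc r) 3c≤ ⟩
  (V + N * 2) * suc r
    ≤⟨ ℕₚ.*-monoˡ-≤ (suc r) (ℕₚ.+-monoʳ-≤ V (ℕₚ.*-monoˡ-≤ 2
         (≤-trans N≤2r (ℕₚ.+-mono-≤ (ℕₚ.m≤n+m r 2) (ℕₚ.m≤n+m r 2))))) ⟩
  (V + (2 + r + (2 + r)) * 2) * suc r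
    ≡⟨ solve 2 (λ V r →
         (V :+ (con 2 :+ r :+ (con 2 :+ r)) :* con 2) :* (con 1 :+ r) :=
         V :* (con 1 :+ r) :+ con 4 :* ((con 1 :+ r) :* (con 2 :+ r))) refl V r ⟩
  V * suc r + 4 * ((1 + r) * (2 + r))
    ≤⟨ ℕₚ.+-monoʳ-≤ (V * suc r) (ℕₚ.*-monoʳ-≤ 4 quad) ⟩
  V * suc r + 4 * (2 * V)
    ≡⟨ solve 2 (λ V r → V :* (con 1 :+ r) :+ con 4 :* (con 2 :* V) :=
         (con 1 :+ r :+ con 8) :* V) refl V r ⟩
  (suc r + 8) * V ∎
  where
  open ℕₚ.≤-Reasoning
  open +-*-Solver

-- Passage to rational inequalities

toℚᵘ-/ : ∀ p q → toℚᵘ (p / suc q) ℚᵘ.≃ mkℚᵘ p q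
toℚᵘ-/ p q = ℚₚ.toℚᵘ-fromℚᵘ (mkℚᵘ p q)

-- `_/_` reduces by a gcd, which blocks computation. For unnormalised fractions the inequality is
-- plain cross-multiplication, and that is `h`.
≤-scaled-third : ∀ c V a r → c * 3 * suc r ≤ (suc r + a) * V →
                 (+ c / 1) ℚ.≤ (1ℚ ℚ.+ + a / suc r) ℚ.* (+ V / 3)
≤-scaled-third c V a r h = ℚₚ.toℚᵘ-cancel-≤ (begin
  toℚᵘ (+ c / 1)
    ≃⟨ toℚᵘ-/ (+ c) 0 ⟩
  mkℚᵘ (+ c) 0
    ≤⟨ ℚᵘ.*≤* (subst₂ ℤ._≤_ lhs rhs (+≤+ h)) ⟩
  (1ℚᵘ ℚᵘ.+ mkℚᵘ (+ a) r) ℚᵘ.* mkℚᵘ (+ V) 2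
    ≃⟨ ℚᵘₚ.*-cong (ℚᵘₚ.≃-trans (ℚₚ.toℚᵘ-homo-+ 1ℚ (+ a / suc r))
                                 (ℚᵘₚ.+-congʳ 1ℚᵘ (toℚᵘ-/ (+ a) r)))
                    (toℚᵘ-/ (+ V) 2) ⟨
  toℚᵘ (1ℚ ℚ.+ + a / suc r) ℚᵘ.* toℚᵘ (+ V / 3)
    ≃⟨ ℚₚ.toℚᵘ-homo-* (1ℚ ℚ.+ + a / suc r) (+ V / 3) ⟨
  toℚᵘ ((1ℚ ℚ.+ + a / suc r) ℚ.* (+ V / 3)) ∎)
  where
  open ℚᵘₚ.≤-Reasoning
  -- `suc (r + 0)` is the unfolded form of the denominator `1 * suc r` of the sum.
  lhs : + (c * 3 * suc r) ≡ + c ℤ.* + (suc (r + 0) * 3)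
  lhs = trans (cong +_ (solve 2 (λ c r → c :* con 3 :* (con 1 :+ r) :=
                 c :* ((con 1 :+ (r :+ con 0)) :* con 3)) refl c r))
              (ℤₚ.pos-* c (suc (r + 0) * 3))
    where open +-*-Solver
  rhs : + ((suc r + a) * V) ≡ (ℤ.1ℤ ℤ.* + suc r ℤ.+ + a ℤ.* ℤ.1ℤ) ℤ.* + V ℤ.* ℤ.1ℤ
  rhs = trans (ℤₚ.pos-* (suc r + a) V) (sym (trans (ℤₚ.*-identityʳ _)
    (cong (ℤ._* + V) (cong₂ ℤ._+_ (ℤₚ.*-identityˡ (+ suc r)) (ℤₚ.*-identityʳ (+ a))))))

8/[1+n+k]⟶0 : ∀ n → (λ k → + 8 / suc (n + k)) ⟶0
8/[1+n+k]⟶0 n δ@(mkℚ (+ zero)  q-1 _) (*<* (+<+ ()))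
-- Let q be the denominator of `δ`. Its numerator is at least 1, so k ≥ 8q gives 8/(1 + n + k) < 1/q
-- ≤ `δ`.
8/[1+n+k]⟶0 n δ@(mkℚ (+ suc p) q-1 _) 0<δ = 8 * suc q-1 , λ k K≤k →
  ℚₚ.toℚᵘ-cancel-< (begin-strict
    toℚᵘ ℚ.∣ + 8 / suc (n + k) ∣    ≃⟨ ℚₚ.toℚᵘ-homo-∣-∣ (+ 8 / suc (n + k)) ⟩
    ℚᵘ.∣ toℚᵘ (+ 8 / suc (n + k)) ∣ ≃⟨ ℚᵘₚ.∣-∣-cong (toℚᵘ-/ (+ 8) (n + k)) ⟩
    mkℚᵘ (+ 8) (n + k)              <⟨ ℚᵘ.*<* (subst (ℤ._< + suc p ℤ.* + suc (n + k))
                                         (ℤₚ.pos-* 8 (suc q-1)) (+<+ (cross k K≤k))) ⟩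
    toℚᵘ δ                          ∎)
  where
  open ℚᵘₚ.≤-Reasoning
  cross : ∀ k → 8 * suc q-1 ≤ k → 8 * suc q-1 < suc p * suc (n + k)
  cross k K≤k = ≤-trans (s≤s (≤-trans K≤k (ℕₚ.m≤n+m k n))) (m≤m+n (suc (n + k)) _)

theorem2 : ∀ (n : ℕ) (2≤n : 2 ≤ n) →
    let G = λ (k : ℕ) → KG (2 * n + k) n (<⇒≤ 2≤n) (≤-trans (m≤m+n n (n + 0)) (m≤m+n (2 * n) k)) in
    ∃ λ (ε : ℕ → ℚ) →
    (ε ⟶0) ×
    (∀ (k : ℕ) → (+ φ (G k) / 1) ℚ.≤ (1ℚ ℚ.+ ε k) ℚ.* (+ ∣V G k ∣ / 3))
-- With r = n + k and N = n + r ≤ 2r, the relative error 2N / |V| is at most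
-- 4N / ((r + 1)(r + 2)) ≤ 8 / (r + 1).
theorem2 n@(suc (suc j)) 2≤n@(s≤s (s≤s _)) =
  (λ k → + 8 / suc (n + k)) , 8/[1+n+k]⟶0 n , λ k →
    let N   = 2 * n + k
        n≤N = ≤-trans (m≤m+n n (n + 0)) (m≤m+n (2 * n) k)
        c   = φ (KG N n (<⇒≤ 2≤n) n≤N)
    in ≤-scaled-third c (N C n) 8 (n + k)
         (quadratic-absorbs-linear c N (N C n) (n + k) (N≤2[n+k] k)
           (3φ≤order+2N N n (<⇒≤ 2≤n) n≤N) (quadratic k))
  where
  split : ∀ k → 2 * n + k ≡ n + (n + k)
  split k = trans (cong (λ m → n + m + k) (ℕₚ.+-identityʳ n)) (ℕₚ.+-assoc n n k)
  N≤2[n+k] : ∀ k → 2 * n + k ≤ (n + k) + (n + k)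
  N≤2[n+k] k = ≤-trans (ℕₚ.≤-reflexive (split k)) (ℕₚ.+-monoˡ-≤ (n + k) (m≤m+n n k))
  quadratic : ∀ k → (1 + (n + k)) * (2 + (n + k)) ≤ 2 * ((2 * n + k) C n)
  -- Here n is `2 + j`, so the top index `2 + j + r` at r = n + k is `n + (n + k)`, which `split`
  -- identifies with `2 * n + k`.
  quadratic k = subst (λ N → (1 + (n + k)) * (2 + (n + k)) ≤ 2 * (N C n)) (sym (split k))
                      (C-lower-quadratic j (n + k))
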